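{- For every $d\in\mathbb{N}$ and every game $\mathcal{M}\subseteq\mathbb{N}_0^d$, the sequence $(\mathcal{M}^i)_{i\ge0}$ converges, i.e. the limit game $\mathcal{M}^\infty$ exists, and $\mathcal{M}^\infty$ is reflexive.
   Context: For $d\in\mathbb{N}$ a game is a set $\mathcal{M}\subseteq\mathbb{N}_0^d$ of moves. From position $\boldsymbol x\in\mathbb{N}_0^d$ a player may move to $\boldsymbol y\in\mathbb{N}_0^d$ iff $\boldsymbol x-\boldsymbol y\in\mathcal{M}$. Misère play: a player who cannot move wins. If $\boldsymbol 0\in\mathcal{M}$, $P(\mathcal{M})=\varnothing$. Otherwise: a position is an N-position if it has no option or some option is a P-position; otherwise it is a P-position; $P(\mathcal{M})$ denotes the set of P-positions. The $\star$-operator is $\mathcal{M}^\star=P(\mathcal{M})$; $\mathcal{M}^0=\mathcal{M}$, $\mathcal{M}^i=(\mathcal{M}^{i-1})^\star$. The limit $\mathcal{M}^\infty$ exists if for every $\boldsymbol x\in\mathbb{N}_0^d$ either $\boldsymbol x\in\mathcal{M}^i$ for all sufficiently large $i$ or $\boldsymbol x\notin\mathcal{M}^i$ for all sufficiently large $i$; then $\mathcal{M}^\infty$ is the set of $\boldsymbol x$ of the first kind. A game is reflexive if $\mathcal{M}=\mathcal{M}^\star$. -}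

module Defs where

open import Data.Nat.Base using (ℕ; zero; suc; _+_; _≤_; _<_)
open import Data.Nat.Induction using (<-wellFounded)
open import Data.Nat.Properties
  using (m<m+n; n≢0⇒n>0; m+n≡0⇒m≡0; m+n≡0⇒n≡0; +-commutativeSemigroup)
open import Algebra.Properties.CommutativeSemigroup +-commutativeSemigroup
  using (interchange)
open import Data.Product.Base using (Σ; ∃; _×_; _,_)
open import Data.Sum.Base using (_⊎_)
open import Data.Vec.Base using (Vec; []; _∷_; replicate; sum; zipWith)
open import Induction.WellFounded using (Acc; acc; WellFounded; module Subrelation)
open import Level using (Level) renaming (suc to lsuc)
open import Relation.Binary.Construct.On as On using ()
open import Relation.Binary.PropositionalEquality
  using (_≡_; refl; sym; trans; cong; cong₂; subst)
open import Relation.Nullary.Negation.Core using (¬_)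
open import Relation.Unary using (Pred; _∈_; _∉_; _≐_)

private
  variable
    ℓ : Level
    d : ℕ

Position : ℕ → Set
Position d = Vec ℕ d

Game : ℕ → (ℓ : Level) → Set (lsuc ℓ)
Game d ℓ = Pred (Position d) ℓ

𝟎 : Position d
𝟎 {d} = replicate d 0

-- y is an option of x iff x - y ∈ M.  The difference is the one in ℤ^d,
-- so it is written additively; truncated subtraction would be wrong here.
OptionOf : Game d ℓ → Position d → Position d → Set ℓ
OptionOf M y x = ∃ λ m → m ∈ M × zipWith _+_ y m ≡ x

private
  sum-zipWith-+ : (x y : Vec ℕ d) → sum (zipWith _+_ x y) ≡ sum x + sum y
  sum-zipWith-+ []       []       = refl
  sum-zipWith-+ (a ∷ x) (b ∷ y) =
    trans (cong (a + b +_) (sum-zipWith-+ x y)) (interchange a b (sum x) (sum y))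

  sum≡0⇒≡𝟎 : (x : Vec ℕ d) → sum x ≡ 0 → x ≡ 𝟎
  sum≡0⇒≡𝟎 []      _  = refl
  sum≡0⇒≡𝟎 (a ∷ x) eq =
    cong₂ _∷_ (m+n≡0⇒m≡0 a eq) (sum≡0⇒≡𝟎 x (m+n≡0⇒n≡0 a eq))

option-sum-< : (M : Game d ℓ) → 𝟎 ∉ M → ∀ {y x} → OptionOf M y x → sum y < sum x
option-sum-< M 𝟎∉M {y} (m , m∈M , refl) =
  subst (sum y <_) (sym (sum-zipWith-+ y m))
    (m<m+n (sum y) (n≢0⇒n>0 λ eq → 𝟎∉M (subst M (sum≡0⇒≡𝟎 m eq) m∈M)))

optionOf-wellFounded : (M : Game d ℓ) → 𝟎 ∉ M → WellFounded (OptionOf M)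
optionOf-wellFounded M 𝟎∉M =
  Subrelation.wellFounded (option-sum-< M 𝟎∉M) (On.wellFounded sum <-wellFounded)

-- Misère outcome classes, by recursion along the options.
mutual
  IsN : (M : Game d ℓ) (x : Position d) → Acc (OptionOf M) x → Set ℓ
  IsN M x (acc rs) =
    (∀ y → ¬ OptionOf M y x) ⊎
    (∃ λ y → Σ (OptionOf M y x) λ o → IsP M y (rs o))

  IsP : (M : Game d ℓ) (x : Position d) → Acc (OptionOf M) x → Set ℓ
  IsP M x a = ¬ IsN M x a

-- The first component makes P M empty when 𝟎 ∈ M.
P : Game d ℓ → Game d ℓ
P M x = Σ (𝟎 ∉ M) λ 𝟎∉M → IsP M x (optionOf-wellFounded M 𝟎∉M x)

infix 9 _⋆
_⋆ : Game d ℓ → Game d ℓ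
M ⋆ = P M

infixl 8 _^⋆_
_^⋆_ : Game d ℓ → ℕ → Game d ℓ
M ^⋆ zero  = M
M ^⋆ suc i = (M ^⋆ i) ⋆

Eventually : (ℕ → Set ℓ) → Set ℓ
Eventually Q = ∃ λ N → ∀ i → N ≤ i → Q i

LimitExists : Game d ℓ → Set ℓ
LimitExists M = ∀ x →
  Eventually (λ i → x ∈ M ^⋆ i) ⊎ Eventually (λ i → x ∉ M ^⋆ i)

infix 9 _^∞
_^∞ : Game d ℓ → Game d ℓ
(M ^∞) x = Eventually (λ i → x ∈ M ^⋆ i)

Reflexive : Game d ℓ → Set ℓ
Reflexive M = M ≐ M ⋆

{-# OPTIONS --safe #-}
-- If 𝟎 ∉ M and x ∈ M, then x has the option 𝟎, which is an N-position.  Hence,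
-- once M and M ⋆ agree on all positions of smaller coordinate sum, the only way
-- x ∈ M itself can influence x ∈ M ⋆ is by making x non-terminal, and x ∈ M ⋆ no
-- longer changes on applying ⋆ again.  By induction on the coordinate sum,
-- membership of x is constant from M ^⋆ (2 + sum x) on.  As ⋆ is local (x ∈ M ⋆
-- depends only on the moves of sum at most sum x), the limit is a fixed point.
module Submission where

open import Defs
open import Axiom.ExcludedMiddle using (ExcludedMiddle)
open import Data.Nat.Base
  using (ℕ; NonZero; zero; suc; _+_; _≤_; _<_; _⊔_; s≤s;
         s≤s⁻¹; _≤′_; ≤′-refl; ≤′-step)
open import Data.Nat.Properties
  using (≤-refl; ≤-reflexive; ≤-trans; ≤-<-trans; <-≤-trans; <⇒≤; <⇒≱; n≮0; m≤n⇒m≤1+n;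
         m≤m⊔n; m≤n⊔m; ≤⇒≤′; ≤′⇒≤; +-identityˡ; +-identityʳ; +-comm; _≟_)
open import Data.Product.Base using (_×_; _,_; proj₁)
open import Data.Sum.Base using (inj₁; inj₂)
open import Data.Vec.Base using (sum; zipWith)
open import Data.Vec.Properties using (zipWith-identityˡ; zipWith-identityʳ; zipWith-comm; ≡-dec)
open import Function.Base using (_∘_)
open import Function.Bundles using (_⇔_; mk⇔; module Equivalence)
open import Function.Construct.Composition using (_⇔-∘_)
open import Function.Construct.Identity using (⇔-id)
open import Function.Construct.Symmetry using (⇔-sym)
open import Induction.WellFounded using (Acc; acc)
open import Level using (Level)
open import Relation.Binary.PropositionalEquality using (_≡_; _≢_; refl; sym; trans; cong; subst)
open import Relation.Nullary.Decidable.Core using (yes; no)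
open import Relation.Nullary.Negation.Core using (¬_; contradiction)
open import Relation.Unary using (_∈_; _∉_)

open Equivalence using (to; from)

private
  variable
    ℓ : Level
    d : ℕ
    M M′ : Game d ℓ
    m x y : Position d

𝟎+m≡x⇒m≡x : zipWith _+_ 𝟎 m ≡ x → m ≡ x
𝟎+m≡x⇒m≡x {m = m} eq = trans (sym (zipWith-identityˡ +-identityˡ m)) eq

-- m is itself an option of x in the game whose only move is y.
move-sum-< : y ≢ 𝟎 → zipWith _+_ y m ≡ x → sum m < sum x
move-sum-< {y = y} {m = m} y≢𝟎 eq =
  option-sum-< (_≡ y) (y≢𝟎 ∘ sym) (y , refl , trans (zipWith-comm +-comm m y) eq)

move-sum-≤ : zipWith _+_ y m ≡ x → sum m ≤ sum x
move-sum-≤ {y = y} eq with ≡-dec _≟_ y 𝟎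
... | yes refl = ≤-reflexive (cong sum (𝟎+m≡x⇒m≡x eq))
... | no  y≢𝟎 = <⇒≤ (move-sum-< y≢𝟎 eq)

-- Each membership in `M ⋆` carries its own proof of `𝟎 ∉ M`, hence its own accessibility proof.
-- `IsP` is a negation, so the induction swaps the two proofs at every option.
IsP-irrelevant : (a b : Acc (OptionOf M) x) → IsP M x a → IsP M x b
IsP-irrelevant (acc rs) (acc rs′) p (inj₁ terminal)    = p (inj₁ terminal)
IsP-irrelevant (acc rs) (acc rs′) p (inj₂ (y , o , q)) =
  p (inj₂ (y , o , IsP-irrelevant (rs′ o) (rs o) q))

Terminal : Game d ℓ → Position d → Set ℓ
Terminal M x = ∀ y → ¬ OptionOf M y x

∈⋆⇒𝟎∉ : x ∈ M ⋆ → 𝟎 ∉ M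
∈⋆⇒𝟎∉ = proj₁

∈⋆⇒¬terminal : x ∈ M ⋆ → ¬ Terminal M x
∈⋆⇒¬terminal {x = x} {M = M} (𝟎∉M , p) t = ¬isP (optionOf-wellFounded M 𝟎∉M x) p
  where
  ¬isP : (a : Acc (OptionOf M) x) → ¬ IsP M x a
  ¬isP (acc _) p = p (inj₁ t)

∈⋆⇒option∉⋆ : x ∈ M ⋆ → OptionOf M y x → y ∉ M ⋆
∈⋆⇒option∉⋆ {x = x} {M = M} {y = y} (𝟎∉M , p) o (𝟎∉M′ , q) =
  ¬isP (optionOf-wellFounded M 𝟎∉M x) p
  where
  ¬isP : (a : Acc (OptionOf M) x) → ¬ IsP M x a
  ¬isP (acc rs) p =
    p (inj₂ (y , o , IsP-irrelevant (optionOf-wellFounded M 𝟎∉M′ y) (rs o) q))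

-- Converse of the three eliminations above; together they characterise `M ⋆` without mentioning
-- accessibility.
∈⋆-intro : 𝟎 ∉ M → ¬ Terminal M x → (∀ {y} → OptionOf M y x → y ∉ M ⋆) → x ∈ M ⋆
∈⋆-intro {M = M} {x = x} 𝟎∉M ¬t no-P = 𝟎∉M , isP (optionOf-wellFounded M 𝟎∉M x)
  where
  isP : (a : Acc (OptionOf M) x) → IsP M x a
  isP (acc rs) (inj₁ t)           = ¬t t
  isP (acc rs) (inj₂ (y , o , q)) =
    no-P o (𝟎∉M , IsP-irrelevant (rs o) (optionOf-wellFounded M 𝟎∉M y) q)

sum-𝟎-≤ : (x : Position d) → sum (𝟎 {d}) ≤ sum x
sum-𝟎-≤ x = move-sum-≤ (zipWith-identityʳ +-identityʳ x)

-- An option of `𝟎` would have a smaller sum, so `𝟎` is terminal and the player to move wins.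
𝟎∉⋆ : (M : Game d ℓ) → 𝟎 ∉ M ⋆
𝟎∉⋆ M 𝟎∈⋆ = ∈⋆⇒¬terminal 𝟎∈⋆ λ y o →
  <⇒≱ (option-sum-< M (∈⋆⇒𝟎∉ 𝟎∈⋆) o) (sum-𝟎-≤ y)

AgreeUpTo : ℕ → Game d ℓ → Game d ℓ → Set ℓ
AgreeUpTo k M M′ = ∀ y → sum y ≤ k → y ∈ M ⇔ y ∈ M′

AgreeUpTo-sym : ∀ {k} → AgreeUpTo k M M′ → AgreeUpTo k M′ M
AgreeUpTo-sym agree y y≤k = ⇔-sym (agree y y≤k)

-- A move available at `x` has sum at most `sum x`, so both games offer the same options there;
-- these have smaller sums, which gives an induction on `k`.
⋆-local : ∀ k → AgreeUpTo k M M′ → AgreeUpTo k (M ⋆) (M′ ⋆)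
⋆-local k agree x x≤k =
  mk⇔ (transfer k agree x≤k) (transfer k (AgreeUpTo-sym agree) x≤k)
  where
  transfer : ∀ k {M M′ : Game d ℓ} {x} → AgreeUpTo k M M′ → sum x ≤ k → x ∈ M ⋆ → x ∈ M′ ⋆
  transfer k {M} {M′} {x} agree x≤k x∈⋆ = ∈⋆-intro 𝟎∉M′
    (λ t → ∈⋆⇒¬terminal x∈⋆ λ where
      y (m , m∈M , eq) →
        t y (m , to (agree m (≤-trans (move-sum-≤ eq) x≤k)) m∈M , eq))
    (λ { o@(m , m∈M′ , eq) y∈M′⋆ →
      ∈⋆⇒option∉⋆ x∈⋆
        (m , from (agree m (≤-trans (move-sum-≤ eq) x≤k)) m∈M′ , eq)
        (back k agree (≤-trans (option-sum-< M′ 𝟎∉M′ o) x≤k) y∈M′⋆) })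
    where
    𝟎∉M′ : 𝟎 ∉ M′
    𝟎∉M′ = ∈⋆⇒𝟎∉ x∈⋆ ∘ from (agree 𝟎 (≤-trans (sum-𝟎-≤ x) x≤k))

    -- At an option the games trade places, and the bound drops by one.
    back : ∀ k {y} → AgreeUpTo k M M′ → sum y < k → y ∈ M′ ⋆ → y ∈ M ⋆
    back (suc k) agree (s≤s y≤k) =
      transfer k (λ z z≤k → ⇔-sym (agree z (m≤n⇒m≤1+n z≤k))) y≤k

⋆-settles : 𝟎 ∉ M → (∀ y → sum y < sum x → y ∈ M ⇔ y ∈ M ⋆) → x ∈ M ⋆ ⇔ x ∈ M ⋆ ⋆
⋆-settles {M = M} {x = x} 𝟎∉M stable = mk⇔ forth back
  where
  stable⋆ : ∀ y → sum y < sum x → y ∈ M ⋆ ⇔ y ∈ M ⋆ ⋆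
  stable⋆ y y<x =
    ⋆-local (sum y) (λ z z≤y → stable z (≤-<-trans z≤y y<x)) y ≤-refl

  forth : x ∈ M ⋆ → x ∈ M ⋆ ⋆
  forth x∈⋆ = ∈⋆-intro (𝟎∉⋆ M)
    -- In the game `M ⋆`, `x` is itself a move, leading to `𝟎`.
    (λ t → t 𝟎 (x , x∈⋆ , zipWith-identityˡ +-identityˡ x))
    no-P
    where
    no-P : ∀ {y} → OptionOf (M ⋆) y x → y ∉ M ⋆ ⋆
    no-P {y} o@(m , m∈⋆ , eq) with ≡-dec _≟_ y 𝟎
    -- Here the move is `x` itself, which `stable` does not cover, but `𝟎` is never a P-position.
    ... | yes refl = 𝟎∉⋆ (M ⋆)
    ... | no  y≢𝟎 =
      ∈⋆⇒option∉⋆ x∈⋆ (m , from (stable m (move-sum-< y≢𝟎 eq)) m∈⋆ , eq)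
      ∘ from (stable⋆ y (option-sum-< (M ⋆) (𝟎∉⋆ M) o))

  back : x ∈ M ⋆ ⋆ → x ∈ M ⋆
  back x∈⋆⋆ = ∈⋆-intro 𝟎∉M (∈⋆⇒¬terminal x∈⋆⋆ ∘ terminal) no-P
    where
    terminal : Terminal M x → Terminal (M ⋆) x
    terminal t y (m , m∈⋆ , eq) with ≡-dec _≟_ y 𝟎
    -- The move is `x`, so `x` is a P-position of `M` and cannot be terminal there.
    ... | yes refl = ∈⋆⇒¬terminal (subst (_∈ M ⋆) (𝟎+m≡x⇒m≡x eq) m∈⋆) t
    ... | no  y≢𝟎 = t y (m , from (stable m (move-sum-< y≢𝟎 eq)) m∈⋆ , eq)

    no-P : ∀ {y} → OptionOf M y x → y ∉ M ⋆
    no-P {y} o@(m , m∈M , eq) with ≡-dec _≟_ y 𝟎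
    ... | yes refl = 𝟎∉⋆ M
    ... | no  y≢𝟎 =
      ∈⋆⇒option∉⋆ x∈⋆⋆ (m , to (stable m (move-sum-< y≢𝟎 eq)) m∈M , eq)
      ∘ to (stable⋆ y (option-sum-< M 𝟎∉M o))

module _ (M : Game d ℓ) where

  -- `⋆-settles` is applied to `M ^⋆ (1 + j)`: one `⋆` removes `𝟎`, a second settles sum zero, and
  -- each further one settles the next sum.
  ^⋆-stable : ∀ j x → sum x ≤ j → x ∈ M ^⋆ (2 + j) ⇔ x ∈ M ^⋆ (3 + j)
  ^⋆-stable j x x≤j = ⋆-settles (𝟎∉⋆ (M ^⋆ j)) (stable-below j x≤j)
    where
    stable-below : ∀ j → sum x ≤ j → ∀ y → sum y < sum x →
                   y ∈ M ^⋆ (1 + j) ⇔ y ∈ M ^⋆ (2 + j)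
    stable-below zero    x≤0  y y<x = contradiction (<-≤-trans y<x x≤0) n≮0
    stable-below (suc j) x≤1+j y y<x = ^⋆-stable j y (s≤s⁻¹ (<-≤-trans y<x x≤1+j))

  ^⋆-constant : ∀ {j i} x → sum x ≤ j → 2 + j ≤′ i → x ∈ M ^⋆ (2 + j) ⇔ x ∈ M ^⋆ i
  ^⋆-constant x x≤j ≤′-refl = ⇔-id _
  -- The match writes `i` as `2 + k`, so the last step is stability at `k`.
  ^⋆-constant {j} {suc i} x x≤j (≤′-step 2+j≤i) with s≤s (s≤s {n = k} j≤k) ← ≤′⇒≤ 2+j≤i =
    ^⋆-stable k x (≤-trans x≤j j≤k) ⇔-∘ ^⋆-constant x x≤j 2+j≤i

  ∈^⋆⇔∈^∞ : ∀ {j} x → sum x ≤ j → x ∈ M ^⋆ (2 + j) ⇔ x ∈ M ^∞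
  ∈^⋆⇔∈^∞ {j} x x≤j = mk⇔
    (λ x∈ → 2 + j , λ i 2+j≤i → to (^⋆-constant x x≤j (≤⇒≤′ 2+j≤i)) x∈)
    -- At the maximum of the two thresholds both constancy and eventual membership apply.
    (λ { (N , ∈≥N) → from (^⋆-constant x x≤j (≤⇒≤′ (m≤m⊔n (2 + j) N)))
                          (∈≥N ((2 + j) ⊔ N) (m≤n⊔m (2 + j) N)) })

  ^∞⇔^∞⋆ : ∀ x → x ∈ M ^∞ ⇔ x ∈ (M ^∞) ⋆
  ^∞⇔^∞⋆ x =
    -- The limit agrees with `M ^⋆ (2 + sum x)` up to `sum x`, so locality carries the agreement
    -- through `⋆`.
    ⋆-local (sum x) (λ y → ∈^⋆⇔∈^∞ y) x ≤-refl
    ⇔-∘ (^⋆-stable (sum x) x ≤-refl ⇔-∘ ⇔-sym (∈^⋆⇔∈^∞ x ≤-refl))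

  ^⋆-converges : ExcludedMiddle ℓ → LimitExists M
  ^⋆-converges em x with em {P = x ∈ M ^⋆ (2 + sum x)}
  ... | yes x∈ = inj₁ (to (∈^⋆⇔∈^∞ x ≤-refl) x∈)
  ... | no  x∉ = inj₂ (2 + sum x , λ i N≤i →
    x∉ ∘ from (^⋆-constant x ≤-refl (≤⇒≤′ N≤i)))

theorem3 : ∀ {ℓ : Level} → ExcludedMiddle ℓ → (d : ℕ) → .{{_ : NonZero d}} → (M : Game d ℓ) → LimitExists M × Reflexive (M ^∞)
theorem3 em d M =
  ^⋆-converges M em , (λ {x} → to (^∞⇔^∞⋆ M x)) , (λ {x} → from (^∞⇔^∞⋆ M x))
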